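{- Consider RESIDUE-THROW-DIVISOR. For all $n\in \mathbb{N}$, $\mathcal{SG}(n)=k$ if $$n\in \{3(2^{k-1}-1)+2,\ldots , 3(2^k-1)+1 \}.$$
   Context: RESIDUE-THROW-DIVISOR is the impartial normal-play heap game where a move from a heap $n$ writes $n=kd+r$ with $1\le d<n$, $0\le r<d$, and moves to the single heap $r$ (the remainder; the $k$ copies of $d$ are discarded); heaps of size $0$ and $1$ have no options. $\mathcal{SG}$ denotes the Sprague-Grundy value (mex rule). -}

module Defs where

open import Data.Nat using (ℕ; zero; suc; _+_; _*_; _∸_; _^_; _≤_; _<_; s≤s; z≤n)
open import Data.Nat.Properties using (≤-trans; <-trans; <-irrefl; _≟_; m≤n⇒m<n∨m≡n; m<1+n⇒m≤n; +-comm; +-suc; +-identityʳ; m≤m+n; m≤n+m; m^n≢0)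
open import Data.Nat.DivMod using (_%_; _/_; m%n<n; m≡m%n+[m/n]*n; [m+kn]%n≡m%n; m<n⇒m%n≡m)
open import Data.Nat.Induction using (<-rec; <-wellFounded)
open import Data.Nat.ListAction using (sum)
open import Data.Integer using (ℤ; +_; -[1+_])
open import Data.Rational using (ℚ) renaming (_/_ to _/ℚ_)
open import Data.Fin using (Fin; toℕ; fromℕ<)
open import Data.Fin.Properties using (toℕ<n; toℕ-fromℕ<)
open import Data.List using (List; _∷_; tabulate)
open import Data.List.Properties using (tabulate-cong)
open import Data.List.Membership.Propositional using (_∈_)
open import Data.List.Membership.Propositional.Properties using (∈-tabulate⁺; ∈-tabulate⁻)
open import Data.List.Membership.DecPropositional _≟_ using (_∈?_)
open import Data.List.Relation.Unary.Any using (here; there)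
open import Data.Product using (∃; ∃-syntax; _×_; _,_; proj₁; proj₂)
open import Data.Sum using (inj₁; inj₂)
open import Induction.WellFounded using (module FixPoint)
open import Relation.Nullary using (¬_; yes; no)
open import Relation.Binary.PropositionalEquality using (_≡_; refl; sym; trans; cong; subst)

-- A move of RESIDUE-THROW-DIVISOR from heap n to heap r.
record _⟶_ (n r : ℕ) : Set where
  constructor move
  field
    k d   : ℕ
    1≤d   : 1 ≤ d
    d<n   : d < n
    r<d   : r < d
    n≡kd+r : n ≡ k * d + r

IsMex : (ℕ → Set) → ℕ → Set
IsMex P g = ¬ P g × (∀ j → j < g → P j)

private
  ∈⇒≤sum : ∀ {x} xs → x ∈ xs → x ≤ sum xs
  ∈⇒≤sum (x ∷ xs) (here refl) = m≤m+n x (sum xs)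
  ∈⇒≤sum (x ∷ xs) (there p)   = ≤-trans (∈⇒≤sum xs p) (m≤n+m (sum xs) x)

  -- Upward search from g; suc (sum xs) exceeds every member of xs.
  search : ∀ xs fuel g → g + fuel ≡ suc (sum xs) →
           (∀ j → j < g → j ∈ xs) → ∃ (IsMex (_∈ xs))
  search xs zero g eq below =
    g , (λ g∈ → <-irrefl (trans (sym (+-identityʳ g)) eq) (s≤s (∈⇒≤sum xs g∈))) , below
  search xs (suc fuel) g eq below with g ∈? xs
  ... | no  g∉ = g , g∉ , below
  ... | yes g∈ = search xs fuel (suc g) (trans (sym (+-suc g fuel)) eq) below′
    where
    below′ : ∀ j → j < suc g → j ∈ xs
    below′ j j<1+g with m≤n⇒m<n∨m≡n (m<1+n⇒m≤n j<1+g)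
    ... | inj₁ j<g  = below j j<g
    ... | inj₂ refl = g∈

mex-exists : ∀ xs → ∃ (IsMex (_∈ xs))
mex-exists xs = search xs (suc (sum xs)) 0 refl (λ _ ())

mex : List ℕ → ℕ
mex xs = proj₁ (mex-exists xs)

-- The index i stands for the divisor d = 1 + i, so d ranges over 1 , … , n ∸ 1.
divisor<n : ∀ n (i : Fin (n ∸ 1)) → suc (toℕ i) < n
divisor<n (suc n) i = s≤s (toℕ<n i)

remainder<n : ∀ n (i : Fin (n ∸ 1)) → n % suc (toℕ i) < n
remainder<n n i = <-trans (m%n<n n (suc (toℕ i))) (divisor<n n i)

SG-step : ∀ n → (∀ {m} → m < n → ℕ) → ℕ
SG-step n rec = mex (tabulate {n = n ∸ 1} (λ i → rec (remainder<n n i)))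

SG : ℕ → ℕ
SG = <-rec (λ _ → ℕ) SG-step

SG-unfold : ∀ n → SG n ≡ mex (tabulate {n = n ∸ 1} (λ i → SG (n % suc (toℕ i))))
SG-unfold n = FixPoint.unfold-wfRec <-wellFounded (λ _ → ℕ) SG-step
  (λ n eq → cong mex (tabulate-cong (λ i → eq (remainder<n n i)))) {n}

private
  index : ∀ {n d} → suc d < n → d < n ∸ 1
  index (s≤s p) = p

  optionAt : ∀ n (i : Fin (n ∸ 1)) → n ⟶ (n % suc (toℕ i))
  optionAt n i = move (n / d) d (s≤s z≤n) (divisor<n n i) (m%n<n n d)
    (trans (m≡m%n+[m/n]*n n d) (+-comm (n % d) _))
    where d = suc (toℕ i)

  optionIndex : ∀ {n r} → n ⟶ r → ∃[ i ] r ≡ n % suc (toℕ {n ∸ 1} i)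
  optionIndex {n} {r} (move k (suc d) _ d<n r<d eq) = fromℕ< (index d<n) ,
    subst (λ e → r ≡ n % suc e) (sym (toℕ-fromℕ< (index d<n)))
      (sym (trans (cong (_% suc d) (trans eq (+-comm _ r)))
           (trans ([m+kn]%n≡m%n r k (suc d)) (m<n⇒m%n≡m r<d))))

-- The mex rule over the moves themselves; by induction on n it determines SG.
SG-mex : ∀ n → IsMex (λ j → ∃[ r ] (n ⟶ r × SG r ≡ j)) (SG n)
SG-mex n = subst (IsMex _) (sym (SG-unfold n)) (absent , present)
  where
  f  : Fin (n ∸ 1) → ℕ
  f i = SG (n % suc (toℕ i))

  toList : ∀ {j} → ∃[ r ] (n ⟶ r × SG r ≡ j) → j ∈ tabulate f
  toList (r , m , refl) with i , eq ← optionIndex m =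
    subst (_∈ tabulate f) (cong SG (sym eq)) (∈-tabulate⁺ i)

  fromList : ∀ {j} → j ∈ tabulate f → ∃[ r ] (n ⟶ r × SG r ≡ j)
  fromList j∈ with i , refl ← ∈-tabulate⁻ {f = f} j∈ = _ , optionAt n i , refl

  mexProof = proj₂ (mex-exists (tabulate f))
  absent   = λ p → proj₁ mexProof (toList p)
  present  = λ j j<g → fromList (proj₂ mexProof j j<g)

fromℕ : ℕ → ℚ
fromℕ n = (+ n) /ℚ 1

-- Rational-valued, because the exponent k - 1 is negative at k = 0.
2^_ : ℤ → ℚ
2^ (+ m)    = fromℕ (2 ^ m)
2^ -[1+ m ] = _/ℚ_ (+ 1) (2 ^ suc m) {{m^n≢0 2 (suc m)}}

infix 8 2^_

{-# OPTIONS --safe #-}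

-- From a heap n ≥ 2 the options are exactly the heaps r with 2r < n: a remainder
-- satisfies n ≥ d + r > 2r, and conversely n = 1·(n − r) + r for r ≥ 1, while d = 1
-- gives r = 0.  Writing t k = 3·2ᵏ − 1, so that t 0 = 2 and t (k+1) = 2 (t k) + 1,
-- induction on k yields that SG n ≤ k for n < t k and that k < SG n for t k ≤ n.

module Submission where

open import Defs
open import Data.Nat using (ℕ)
open import Data.Integer using (+_) renaming (_-_ to _-ℤ_)
open import Data.Rational using (_+_; _*_; _-_; _≤_)
open import Relation.Binary.PropositionalEquality using (_≡_)

open import Data.Nat.Base as ℕ using (zero; suc; s≤s; z≤n)
import Data.Nat.Properties as ℕ
import Data.Nat.Tactic.RingSolver as ℕ-Solver
open import Data.Integer.Base as ℤ using (ℤ)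
import Data.Integer.Properties as ℤ
import Data.Integer.Tactic.RingSolver as ℤ-Solver
open import Data.Rational.Base using (_/_)
import Data.Rational.Properties as ℚ
open import Data.Rational.Literals using (fromℤ)
open import Data.Empty using (⊥-elim)
open import Data.Product using (_,_; proj₁; proj₂)
open import Relation.Binary.PropositionalEquality using (_≢_; refl; sym; trans; cong; cong₂; subst; subst₂; module ≡-Reasoning)

option⇒2r<n : ∀ {n r} → n ⟶ r → r ℕ.+ r ℕ.< n
-- A zero quotient would make `n` equal to `r`, so `d < n` would contradict `r < d`.
option⇒2r<n {r = r} (move zero d _ d<n r<d eq) =
  ⊥-elim (ℕ.<-asym r<d (subst (d ℕ.<_) eq d<n))
option⇒2r<n {n} {r} (move (suc k) d _ _ r<d eq) = begin-strict
  r ℕ.+ r              <⟨ ℕ.+-monoˡ-< r r<d ⟩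
  d ℕ.+ r              ≤⟨ ℕ.+-monoˡ-≤ r (ℕ.m≤m+n d (k ℕ.* d)) ⟩
  suc k ℕ.* d ℕ.+ r    ≡⟨ sym eq ⟩
  n                    ∎
  where open ℕ.≤-Reasoning

2≤n⇒option-0 : ∀ {n} → 2 ℕ.≤ n → n ⟶ 0
2≤n⇒option-0 {n} 2≤n = move n 1 ℕ.≤-refl 2≤n (s≤s z≤n)
  (sym (trans (ℕ.+-identityʳ _) (ℕ.*-identityʳ n)))

2r<n⇒option : ∀ {n r} → 0 ℕ.< r → r ℕ.+ r ℕ.< n → n ⟶ r
-- With divisor `n ∸ r`, `0 < r` keeps it below `n` and `r + r < n` makes it exceed `r`.
2r<n⇒option {n} {r} 0<r 2r<n = move 1 (n ℕ.∸ r) (ℕ.≤-trans 0<r (ℕ.<⇒≤ r<d))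
  (ℕ.∸-monoʳ-< 0<r r≤n) r<d
  (sym (trans (cong (ℕ._+ r) (ℕ.*-identityˡ (n ℕ.∸ r))) (ℕ.m∸n+n≡m r≤n)))
  where
  r≤n : r ℕ.≤ n
  r≤n = ℕ.≤-trans (ℕ.m≤m+n r r) (ℕ.<⇒≤ 2r<n)

  r<d : r ℕ.< n ℕ.∸ r
  r<d = ℕ.m+n≤o⇒m≤o∸n (suc r) 2r<n

option⇒SG≢ : ∀ {n r} → n ⟶ r → SG r ≢ SG n
option⇒SG≢ {n} {r} m eq = proj₁ (SG-mex n) (r , m , eq)

no-option-value⇒SG≤ : ∀ {n k} → (∀ {r} → n ⟶ r → SG r ≢ k) → SG n ℕ.≤ k
no-option-value⇒SG≤ {n} {k} absent = ℕ.≮⇒≥ λ k<SG →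
  let r , m , eq = proj₂ (SG-mex n) k k<SG in absent m eq

-- `threshold (suc k)` is the least heap that has `threshold k` as an option.
threshold : ℕ → ℕ
threshold zero    = 2
threshold (suc k) = suc (threshold k ℕ.+ threshold k)

-- Shifting by one turns the recursion into plain doubling, starting from 3.
suc-threshold : ∀ k → suc (threshold k) ≡ 3 ℕ.* 2 ℕ.^ k
suc-threshold zero    = refl
suc-threshold (suc k) = begin
  suc (suc (threshold k ℕ.+ threshold k))  ≡⟨ cong suc (sym (ℕ.+-suc _ _)) ⟩
  suc (threshold k) ℕ.+ suc (threshold k)  ≡⟨ cong₂ ℕ._+_ (suc-threshold k) (suc-threshold k) ⟩
  3 ℕ.* 2 ℕ.^ k ℕ.+ 3 ℕ.* 2 ℕ.^ k          ≡⟨ double (2 ℕ.^ k) ⟩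
  3 ℕ.* 2 ℕ.^ suc k                        ∎
  where
  open ≡-Reasoning
  double : ∀ x → 3 ℕ.* x ℕ.+ 3 ℕ.* x ≡ 3 ℕ.* (2 ℕ.* x)
  double = ℕ-Solver.solve-∀

threshold-pos : ∀ k → 0 ℕ.< threshold k
threshold-pos zero    = s≤s z≤n
threshold-pos (suc k) = s≤s z≤n

threshold-suc : ∀ k → threshold k ℕ.< threshold (suc k)
threshold-suc k = s≤s (ℕ.m≤m+n _ _)

m+m<n+n⇒m<n : ∀ m n → m ℕ.+ m ℕ.< n ℕ.+ n → m ℕ.< n
m+m<n+n⇒m<n m n 2m<2n = ℕ.≰⇒> λ n≤m → ℕ.<⇒≱ 2m<2n (ℕ.+-mono-≤ n≤m n≤m)

-- It suffices that no option has the value `k`. Below 2 there are no moves; below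
-- `threshold (suc k)` every option lies below `threshold k`, so by induction its value is at most
-- `k`.
n<threshold⇒SG≤ : ∀ k {n} → n ℕ.< threshold k → SG n ℕ.≤ k
n<threshold⇒SG≤ zero (s≤s n≤1) = no-option-value⇒SG≤ λ (move _ _ 1≤d d<n _ _) _ →
  ℕ.<⇒≱ d<n (ℕ.≤-trans n≤1 1≤d)
n<threshold⇒SG≤ (suc k) {n} (s≤s n≤2t) = no-option-value⇒SG≤ λ {r} m eq →
  let r<t = m+m<n+n⇒m<n r (threshold k) (ℕ.<-≤-trans (option⇒2r<n m) n≤2t)
  in ℕ.1+n≰n (subst (ℕ._≤ k) eq (n<threshold⇒SG≤ k r<t))

-- Induction leaves only `SG n ≡ suc k` to exclude, and the option `threshold k` already has that
-- value.
threshold≤n⇒<SG : ∀ k {n} → threshold k ℕ.≤ n → k ℕ.< SG n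
threshold≤n⇒<SG zero 2≤n = ℕ.n≢0⇒n>0 λ SGn≡0 →
  option⇒SG≢ (2≤n⇒option-0 2≤n) (trans (ℕ.n≤0⇒n≡0 (n<threshold⇒SG≤ 0 (s≤s z≤n))) (sym SGn≡0))
threshold≤n⇒<SG (suc k) {n} t≤n = ℕ.≤∧≢⇒< (threshold≤n⇒<SG k (ℕ.≤-trans (ℕ.<⇒≤ (threshold-suc k)) t≤n))
  λ 1+k≡SGn → option⇒SG≢ (2r<n⇒option (threshold-pos k) t≤n) (trans SG-threshold 1+k≡SGn)
  where
  SG-threshold : SG (threshold k) ≡ suc k
  SG-threshold = ℕ.≤-antisym (n<threshold⇒SG≤ (suc k) (threshold-suc k)) (threshold≤n⇒<SG k ℕ.≤-refl)

-- `i / 1` is stuck for a variable `i`, whereas `fromℤ i` exposes its numerator and denominator.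
/1≡fromℤ : ∀ i → i / 1 ≡ fromℤ i
/1≡fromℤ i = ℚ.↥p/↧p≡p (fromℤ i)

fromℤ-homo-+ : ∀ i j → fromℤ i + fromℤ j ≡ fromℤ (i ℤ.+ j)
fromℤ-homo-+ i j = trans (cong (_/ 1) (cong₂ ℤ._+_ (ℤ.*-identityʳ i) (ℤ.*-identityʳ j)))
  (/1≡fromℤ (i ℤ.+ j))

fromℤ-homo-* : ∀ i j → fromℤ i * fromℤ j ≡ fromℤ (i ℤ.* j)
fromℤ-homo-* i j = /1≡fromℤ (i ℤ.* j)

fromℤ-cancel-≤ : ∀ {i j} → fromℤ i ≤ fromℤ j → i ℤ.≤ j
fromℤ-cancel-≤ i≤j = subst₂ ℤ._≤_ (ℤ.*-identityʳ _) (ℤ.*-identityʳ _) (ℚ.drop-*≤* i≤j)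

bound : ℕ → ℕ → ℤ
bound a c = + 3 ℤ.* (+ a -ℤ + 1) ℤ.+ + c

fromℤ-bound : ∀ a c → fromℕ 3 * (fromℕ a - fromℕ 1) + fromℕ c ≡ fromℤ (bound a c)
fromℤ-bound a c = begin
  fromℕ 3 * (fromℕ a - fromℕ 1) + fromℕ c
    ≡⟨ cong₂ (λ x y → fromℕ 3 * (x - fromℕ 1) + y) (/1≡fromℤ (+ a)) (/1≡fromℤ (+ c)) ⟩
  fromℤ (+ 3) * (fromℤ (+ a) + fromℤ (ℤ.- (+ 1))) + fromℤ (+ c)
    ≡⟨ cong (λ x → fromℤ (+ 3) * x + fromℤ (+ c)) (fromℤ-homo-+ (+ a) (ℤ.- (+ 1))) ⟩
  fromℤ (+ 3) * fromℤ (+ a -ℤ + 1) + fromℤ (+ c)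
    ≡⟨ cong (_+ fromℤ (+ c)) (fromℤ-homo-* (+ 3) (+ a -ℤ + 1)) ⟩
  fromℤ (+ 3 ℤ.* (+ a -ℤ + 1)) + fromℤ (+ c)
    ≡⟨ fromℤ-homo-+ (+ 3 ℤ.* (+ a -ℤ + 1)) (+ c) ⟩
  fromℤ (bound a c) ∎
  where open ≡-Reasoning

-- Adding 3 cancels the subtraction, so the bounds pass to ℕ without truncated subtraction.
bound+3 : ∀ a c → bound a c ℤ.+ + 3 ≡ + (3 ℕ.* a ℕ.+ c)
bound+3 a c = trans (rearrange (+ a) (+ c)) (cong (ℤ._+ + c) (sym (ℤ.pos-* 3 a)))
  where
  rearrange : ∀ x y → + 3 ℤ.* (x -ℤ + 1) ℤ.+ y ℤ.+ + 3 ≡ + 3 ℤ.* x ℤ.+ y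
  rearrange = ℤ-Solver.solve-∀

lower-bound⇒ℕ : ∀ a c n → fromℕ 3 * (fromℕ a - fromℕ 1) + fromℕ c ≤ fromℕ n → 3 ℕ.* a ℕ.+ c ℕ.≤ n ℕ.+ 3
lower-bound⇒ℕ a c n h = ℤ.drop‿+≤+ (subst (ℤ._≤ + (n ℕ.+ 3)) (bound+3 a c)
  (ℤ.+-monoˡ-≤ (+ 3) (fromℤ-cancel-≤ (subst₂ _≤_ (fromℤ-bound a c) (/1≡fromℤ (+ n)) h))))

upper-bound⇒ℕ : ∀ a c n → fromℕ n ≤ fromℕ 3 * (fromℕ a - fromℕ 1) + fromℕ c → n ℕ.+ 3 ℕ.≤ 3 ℕ.* a ℕ.+ c
upper-bound⇒ℕ a c n h = ℤ.drop‿+≤+ (subst (+ (n ℕ.+ 3) ℤ.≤_) (bound+3 a c)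
  (ℤ.+-monoˡ-≤ (+ 3) (fromℤ-cancel-≤ (subst₂ _≤_ (/1≡fromℤ (+ n)) (fromℤ-bound a c) h))))

lower-bound⇒threshold≤ : ∀ k n → fromℕ 3 * (2^ (+ k) - fromℕ 1) + fromℕ 2 ≤ fromℕ n → threshold k ℕ.≤ n
lower-bound⇒threshold≤ k n h = ℕ.+-cancelʳ-≤ 3 _ _
  (subst (ℕ._≤ n ℕ.+ 3) eq (lower-bound⇒ℕ (2 ℕ.^ k) 2 n h))
  where
  eq : 3 ℕ.* 2 ℕ.^ k ℕ.+ 2 ≡ threshold k ℕ.+ 3
  eq = trans (cong (ℕ._+ 2) (sym (suc-threshold k))) (sym (ℕ.+-suc (threshold k) 2))

upper-bound⇒<threshold : ∀ k n → fromℕ n ≤ fromℕ 3 * (2^ (+ k) - fromℕ 1) + fromℕ 1 → n ℕ.< threshold k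
upper-bound⇒<threshold k n h = ℕ.+-cancelʳ-≤ 2 _ _
  -- Reading `n + 3` as `suc n + 2` leaves a strict inequality once 2 is cancelled.
  (subst₂ ℕ._≤_ (ℕ.+-suc n 2) eq (upper-bound⇒ℕ (2 ℕ.^ k) 1 n h))
  where
  eq : 3 ℕ.* 2 ℕ.^ k ℕ.+ 1 ≡ threshold k ℕ.+ 2
  eq = trans (cong (ℕ._+ 1) (sym (suc-threshold k))) (sym (ℕ.+-suc (threshold k) 1))

mainTheorem12 : (n k : ℕ) →
    fromℕ 3 * (2^ (+ k -ℤ + 1) - fromℕ 1) + fromℕ 2 ≤ fromℕ n →
    fromℕ n ≤ fromℕ 3 * (2^ (+ k) - fromℕ 1) + fromℕ 1 →
    SG n ≡ k
mainTheorem12 n zero    _  hi = ℕ.n≤0⇒n≡0 (n<threshold⇒SG≤ 0 (upper-bound⇒<threshold 0 n hi))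
-- The exponent `+ suc k - + 1` computes to `+ k`, so `lo` places `n` at or above `threshold k`.
mainTheorem12 n (suc k) lo hi = ℕ.≤-antisym
  (n<threshold⇒SG≤ (suc k) (upper-bound⇒<threshold (suc k) n hi))
  (threshold≤n⇒<SG k (lower-bound⇒threshold≤ k n lo))
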